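{- For every integer $n\geq 5$, $$\mathrm{MOP}(n,2)\ \geq\ \left\lceil\frac{4n+10}{9}\right\rceil ,$$ with equality when $n\equiv 2\ (\mathrm{mod}\ 18)$, and $\mathrm{MOP}(n,2)\leq\left\lceil(4n+10)/9\right\rceil+43$ for every $n\geq 20$. In particular $\mathrm{MOP}(n,2)=4n/9+O(1)$.
   Context: For a graph $G$ and $B\subseteq V(G)$ the spread is $\mathrm{sp}(B)=\max_{u\in B}\deg_G(u)-\min_{v\in B}\deg_G(v)$, and $\mathrm{sp}(G,k)$ is the largest cardinality of a set $B\subseteq V(G)$ with $\mathrm{sp}(B)\leq k$. A graph is maximal outerplanar (a MOP) if it is outerplanar and the addition of any edge destroys outerplanarity; equivalently, a MOP of order $n\geq 3$ is a triangulation of a convex $n$-gon (the graph formed by the sides of the $n$-gon and $n-3$ pairwise non-crossing diagonals). $\mathrm{MOP}(n,k)=\min\{\mathrm{sp}(G,k):G\text{ is a MOP of order }n\}$. -}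

module Defs where

open import Data.Fin.Base using (Fin; _<_)
open import Data.Fin.Permutation using (Permutation′; _⟨$⟩ʳ_)
open import Data.Fin.Properties using (_≟_)
open import Data.Fin.Subset using (Subset; inside; outside; ∣_∣)
open import Data.Fin.Subset.Properties using (_∈?_)
open import Data.List.Base using (List; []; _∷_; _++_; map; filter; length; allFin)
open import Data.List.Extrema.Nat using (max; min)
open import Data.Nat.Base using (ℕ; zero; suc; _∸_; _≤_)
open import Data.Nat.Properties using (_≤?_)
open import Data.Product.Base using (_×_; _,_; ∃-syntax)
open import Data.Sum.Base using (_⊎_; inj₁; inj₂)
open import Data.Vec.Base using ([]; _∷_)
open import Level using (0ℓ)
open import Relation.Binary.Core using (Rel)
open import Relation.Binary.Definitions using (Symmetric; Irreflexive; Decidable)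
open import Relation.Binary.PropositionalEquality.Core using (_≡_; _≢_; refl; sym)
open import Relation.Nullary.Decidable using (_×-dec_; _⊎-dec_)
open import Relation.Nullary.Negation using (¬_)

record Graph (n : ℕ) : Set₁ where
  infix 4 _~_ _~?_
  field
    _~_      : Rel (Fin n) 0ℓ
    ~-sym    : Symmetric _~_
    ~-irrefl : Irreflexive _≡_ _~_
    _~?_     : Decidable _~_

  degree : Fin n → ℕ
  degree v = length (filter (v ~?_) (allFin n))

open Graph public using (degree)

addEdge : ∀ {n} (G : Graph n) {u v : Fin n} → u ≢ v → Graph n
addEdge {n} G {u} {v} u≢v = record
  { _~_      = _~′_
  ; ~-sym    = λ
    { (inj₁ x~y)                  → inj₁ (~-sym x~y)
    ; (inj₂ (inj₁ (x≡u , y≡v)))   → inj₂ (inj₂ (y≡v , x≡u))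
    ; (inj₂ (inj₂ (x≡v , y≡u)))   → inj₂ (inj₁ (y≡u , x≡v))
    }
  ; ~-irrefl = λ
    { x≡y  (inj₁ x~y)                  → ~-irrefl x≡y x~y
    ; refl (inj₂ (inj₁ (refl , x≡v)))  → u≢v x≡v
    ; refl (inj₂ (inj₂ (refl , x≡u)))  → u≢v (sym x≡u)
    }
  ; _~?_     = λ x y → (x ~? y) ⊎-dec
                       ((x ≟ u ×-dec y ≟ v) ⊎-dec (x ≟ v ×-dec y ≟ u))
  }
  where
  open Graph G
  _~′_ : Rel (Fin n) 0ℓ
  x ~′ y = x ~ y ⊎ ((x ≡ u × y ≡ v) ⊎ (x ≡ v × y ≡ u))

-- With the corners of a convex n-gon numbered cyclically by Fin n, the
-- chords ab and cd cross in their interiors iff, after possibly swapping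
-- the ends of each chord and the two chords, a < c < b < d.  Since _~_ is
-- symmetric, ranging over all u ~ v and x ~ y covers every such swap.
NonCrossing : ∀ {n} → Graph n → Permutation′ n → Set
NonCrossing G π = ∀ {u v x y} → u ~ v → x ~ y →
  ¬ (pos u < pos x × pos x < pos v × pos v < pos y)
  where
  open Graph G
  pos = π ⟨$⟩ʳ_

-- Combinatorial form of outerplanarity: the vertices can be placed at the
-- corners of a convex n-gon so that no two edges, drawn as chords, cross.
Outerplanar : ∀ {n} → Graph n → Set
Outerplanar {n} G = ∃[ π ] NonCrossing G π

record IsMOP {n : ℕ} (G : Graph n) : Set where
  open Graph G using (_~_)
  field
    outerplanar : Outerplanar G
    maximal     : ∀ {u v} (u≢v : u ≢ v) → ¬ (u ~ v) →
                  ¬ Outerplanar (addEdge G u≢v)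

degreesIn : ∀ {n} → Graph n → Subset n → List ℕ
degreesIn {n} G B = map (degree G) (filter (_∈? B) (allFin n))

-- The first arguments of max and min are the values for empty lists.
-- As 0 ≤ degree G v ≤ n, they do not matter when B is nonempty, and the
-- empty set gets spread 0.
spread : ∀ {n} → Graph n → Subset n → ℕ
spread {n} G B = max 0 (degreesIn G B) ∸ min n (degreesIn G B)

subsets : ∀ n → List (Subset n)
subsets zero    = [] ∷ []
subsets (suc n) = map (inside ∷_) (subsets n) ++ map (outside ∷_) (subsets n)

sp : ∀ {n} → Graph n → ℕ → ℕ
sp {n} G k = max 0 (map ∣_∣ (filter (λ B → spread G B ≤? k) (subsets n)))

-- m = MOP(n,k)
record IsMOPNumber (n k m : ℕ) : Set₁ where
  field
    attained   : ∃[ G ] (IsMOP {n} G × sp G k ≡ m)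
    lowerBound : ∀ (G : Graph n) → IsMOP G → m ≤ sp G k

{-# OPTIONS --safe #-}

-- A maximal outerplanar graph of order n is a triangulated n-gon, and fixing one
-- side turns the triangulation into a binary tree; conversely every non-crossing
-- graph is contained in a triangulation, and all triangulations have 2n - 3 edges.
--
-- Lower bound: every degree d ≥ 2 satisfies
--   8 + 2 [3 ≤ d ≤ 4] ≤ d + 6 [2 ≤ d ≤ 4] + 2 [5 ≤ d ≤ 7] + [3 ≤ d ≤ 5].
-- Two corners have degree 3 or 4, the degrees add up to 4n - 6, and each of the
-- three windows has at most sp(G,2) corners, so 4n + 10 ≤ 9 sp(G,2).
--
-- Upper bound: equality leaves only the degrees 2, 5, 8 in proportion 4 : 4 : 1 (and
-- two corners each of degree 3 and 6), which a periodic strip with ears realises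
-- when n ≡ 2 (mod 18).  Each further ear adds at most 3 corners to a window.
module Submission where

open import Defs
open import Data.Bool.Base using (if_then_else_; true; false)
open import Data.Fin.Base as Fin using (Fin; zero; suc; toℕ)
open import Data.Fin.Permutation as Perm using (Permutation′; _⟨$⟩ʳ_; inverseˡ)
import Data.Fin.Properties as Fin
open import Data.Fin.Subset using (Subset; inside; outside; ∣_∣) renaming (_∈_ to _∈ˢ_)
open import Data.Fin.Subset.Properties using (_∈?_)
open import Data.Integer.Base as ℤ using (+_; +≤+)
import Data.Integer.DivMod as ℤ
import Data.Integer.Properties as ℤ
open import Data.Integer.Tactic.RingSolver using () renaming (solve-∀ to ℤ-solve-∀)
open import Data.List.Base using (List; []; _∷_; filter; length; allFin; tabulate; cartesianProductWith)
open import Data.List.Extrema.Nat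
  using (max; min; max≤v⁺; v≤min⁺; v≤max⁺; min≤⊤; xs≤max; min≤xs; argmin; argmin-all; f[argmin]≤f[xs])
open import Data.List.Membership.Propositional using (_∈_; lose)
open import Data.List.Membership.Propositional.Properties
  using (∈-map⁺; ∈-filter⁺; ∈-++⁺ˡ; ∈-++⁺ʳ; ∈-allFin; ∈-cartesianProductWith⁺)
open import Data.List.Relation.Unary.All as All using (All)
import Data.List.Relation.Unary.All.Properties as All
open import Data.List.Relation.Unary.Any using (here; there)
open import Data.Nat.Base as ℕ hiding (_/_)
open import Data.Nat.DivMod using (m≡m%n+[m/n]*n; m%n<n)
open import Data.Nat.Properties
open import Data.Nat.Solver using (module +-*-Solver)
open import Data.Nat.Tactic.RingSolver using (solve-∀)
open import Data.Product.Base using (_×_; _,_; proj₁; proj₂; Σ-syntax; ∃-syntax)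
open import Data.Rational.Unnormalised.Base as ℚᵘ using (_/_; ceiling)
open import Data.Sum.Base using (_⊎_; inj₁; inj₂; swap)
open import Data.Unit.Base using (tt)
import Data.Vec.Base as Vec
open import Data.Vec.Properties using (lookup∘tabulate; lookup⇒[]=; []=⇒lookup)
open import Function.Base using (_∘_; id)
open import Relation.Binary.Definitions using (tri<; tri≈; tri>)
open import Relation.Binary.PropositionalEquality
open import Relation.Nullary.Decidable
  using (Dec; yes; no; does; _×-dec_; _⊎-dec_; dec-true; dec-false; decidable-stable)
open import Relation.Nullary.Negation using (¬_; contradiction)
open import Relation.Unary using (Pred; Decidable)
open import Algebra.Properties.Semiring.Sum +-*-semiring
  using (sum; sum-cong-≗; sum-replicate-zero; ∑-distrib-+; sum-permute; *-distribˡ-sum)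
open +-*-Solver using (solve; con; _:+_; _:*_; _:=_)

private variable
  X Y : Set
  N : ℕ

-- Indicators of decidable propositions and finite sums.

witness : (X? : Dec X) → does X? ≡ true → X
witness (yes p) _ = p

ind : Dec X → ℕ
ind X? = if does X? then 1 else 0

ind-yes : (X? : Dec X) → X → ind X? ≡ 1
ind-yes X? p rewrite dec-true X? p = refl

ind-no : (X? : Dec X) → ¬ X → ind X? ≡ 0
ind-no X? ¬p rewrite dec-false X? ¬p = refl

ind-mono : (X? : Dec X) (Y? : Dec Y) → (X → Y) → ind X? ≤ ind Y?
ind-mono (no _)  Y? X⇒Y = z≤n
ind-mono (yes p) Y? X⇒Y = ≤-reflexive (sym (ind-yes Y? (X⇒Y p)))

ind-cong : (X? : Dec X) (Y? : Dec Y) → (X → Y) → (Y → X) → ind X? ≡ ind Y?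
ind-cong X? Y? X⇒Y Y⇒X = ≤-antisym (ind-mono X? Y? X⇒Y) (ind-mono Y? X? Y⇒X)

ind≤1 : (X? : Dec X) → ind X? ≤ 1
ind≤1 (yes _) = ≤-refl
ind≤1 (no _)  = z≤n

ind-⊎ : (X? : Dec X) (Y? : Dec Y) → (X → ¬ Y) → ind (X? ⊎-dec Y?) ≡ ind X? + ind Y?
ind-⊎ (no _)  Y? disjoint = refl
ind-⊎ (yes p) Y? disjoint = cong suc (sym (ind-no Y? (disjoint p)))

ind-× : (X? : Dec X) (Y? : Dec Y) → ind (X? ×-dec Y?) ≡ ind X? * ind Y?
ind-× (no _)  Y? = refl
ind-× (yes _) Y? = sym (+-identityʳ _)

sum-mono : (f g : Fin N → ℕ) → (∀ i → f i ≤ g i) → sum f ≤ sum g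
sum-mono {zero}  f g f≤g = z≤n
sum-mono {suc n} f g f≤g = +-mono-≤ (f≤g zero) (sum-mono (f ∘ suc) (g ∘ suc) (f≤g ∘ suc))

sum-mono-< : (f g : Fin N → ℕ) → (∀ i → f i ≤ g i) → ∀ i → f i < g i → sum f < sum g
sum-mono-< f g f≤g zero    fᵢ<gᵢ = +-mono-<-≤ fᵢ<gᵢ (sum-mono (f ∘ suc) (g ∘ suc) (f≤g ∘ suc))
sum-mono-< f g f≤g (suc i) fᵢ<gᵢ = +-mono-≤-< (f≤g zero) (sum-mono-< (f ∘ suc) (g ∘ suc) (f≤g ∘ suc) i fᵢ<gᵢ)

length-filter-tabulate : {A : Set} {P : Pred A _} (P? : Decidable P) (f : Fin N → A) →
  length (filter P? (tabulate f)) ≡ sum (ind ∘ P? ∘ f)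
length-filter-tabulate {zero}  P? f = refl
length-filter-tabulate {suc n} P? f with does (P? (f zero))
... | true  = cong suc (length-filter-tabulate P? (f ∘ suc))
... | false = length-filter-tabulate P? (f ∘ suc)

degree-sum : (G : Graph N) (v : Fin N) → degree G v ≡ sum (λ w → ind (Graph._~?_ G v w))
degree-sum G v = length-filter-tabulate (Graph._~?_ G v) id

card-sum : (B : Subset N) → ∣ B ∣ ≡ sum (λ i → ind (i ∈? B))
card-sum Vec.[]            = refl
card-sum (inside Vec.∷ B)  = cong suc (card-sum B)
card-sum (outside Vec.∷ B) = card-sum B

∈-subsets : (B : Subset N) → B ∈ subsets N
∈-subsets Vec.[]            = here refl
∈-subsets (inside Vec.∷ B)  = ∈-++⁺ˡ (∈-map⁺ _ (∈-subsets B))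
∈-subsets (outside Vec.∷ B) = ∈-++⁺ʳ _ (∈-map⁺ _ (∈-subsets B))

-- Spread-bounded vertex sets as degree windows.

Window : ℕ → ℕ → ℕ → Set
Window k d x = d ≤ x × x ≤ d + k

window? : ∀ k d x → Dec (Window k d x)
window? k d x = d ≤? x ×-dec x ≤? d + k

win : ℕ → ℕ → ℕ → ℕ
win k d x = ind (window? k d x)

count : Graph N → ℕ → ℕ → ℕ
count G k d = sum (λ v → win k d (degree G v))

-- The vertices with degree in the window form a set of spread at most `k`, one of the candidates in
-- `sp`.
count≤sp : (G : Graph N) (k : ℕ) {d : ℕ} → d ≤ N → count G k d ≤ sp G k
count≤sp {N} G k {d} d≤n = begin
  count G k d              ≡⟨ sum-cong-≗ (λ v → ind-cong (window? k d _) (v ∈? B) ∈B⁺ ∈B⁻) ⟩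
  sum (λ v → ind (v ∈? B)) ≡⟨ card-sum B ⟨
  ∣ B ∣                    ≤⟨ v≤max⁺ 0 _ (inj₂ (lose (∈-map⁺ ∣_∣ B∈) ≤-refl)) ⟩
  sp G k                   ∎
  where
  open ≤-Reasoning
  B : Subset N
  B = Vec.tabulate (λ v → does (window? k d (degree G v)))
  ∈B⁺ : ∀ {v} → Window k d (degree G v) → v ∈ˢ B
  ∈B⁺ {v} w = lookup⇒[]= v B (trans (lookup∘tabulate _ v) (dec-true (window? k d _) w))
  ∈B⁻ : ∀ {v} → v ∈ˢ B → Window k d (degree G v)
  ∈B⁻ {v} v∈B = witness (window? k d _) (trans (sym (lookup∘tabulate _ v)) ([]=⇒lookup v∈B))
  inB : All (λ v → v ∈ˢ B) (filter (_∈? B) (allFin N))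
  inB = All.all-filter (_∈? B) (allFin N)
  spread≤k : spread G B ≤ k
  spread≤k = m≤n+o⇒m∸n≤o _ _ (begin
    max 0 (degreesIn G B)     ≤⟨ max≤v⁺ z≤n (All.map⁺ (All.map (proj₂ ∘ ∈B⁻) inB)) ⟩
    -- `min` starts from the default `N`, so the lower bound `d` must hold for `N` too; `d ≤ N`
    -- supplies this.
    d + k                     ≤⟨ +-monoˡ-≤ k (v≤min⁺ d≤n (All.map⁺ (All.map (proj₁ ∘ ∈B⁻) inB))) ⟩
    min N (degreesIn G B) + k ∎)
  B∈ : B ∈ filter (λ B → spread G B ≤? k) (subsets N)
  B∈ = ∈-filter⁺ (λ B → spread G B ≤? k) (∈-subsets B) spread≤k

-- A set of spread at most `k` lies in the window that begins at its least degree.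
sp≤ : (G : Graph N) (k : ℕ) {m : ℕ} → (∀ {d} → d ≤ N → count G k d ≤ m) → sp G k ≤ m
sp≤ {N} G k {m} count≤m =
  max≤v⁺ z≤n (All.map⁺ (All.map card≤m (All.all-filter (λ B → spread G B ≤? k) (subsets N))))
  where
  open ≤-Reasoning
  card≤m : ∀ {B} → spread G B ≤ k → ∣ B ∣ ≤ m
  card≤m {B} spread≤k = begin
    ∣ B ∣                    ≡⟨ card-sum B ⟩
    sum (λ v → ind (v ∈? B)) ≤⟨ sum-mono _ _ (λ v → ind-mono (v ∈? B) (window? k d _) inWindow) ⟩
    count G k d              ≤⟨ count≤m (min≤⊤ N (degreesIn G B)) ⟩
    m                        ∎
    where
    d = min N (degreesIn G B)
    inWindow : ∀ {v} → v ∈ˢ B → Window k d (degree G v)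
    inWindow {v} v∈B = All.lookup (min≤xs N _) deg∈ , (begin
      degree G v                       ≤⟨ All.lookup (xs≤max 0 _) deg∈ ⟩
      max 0 (degreesIn G B)            ≤⟨ m≤n+m∸n _ d ⟩
      d + spread G B                   ≤⟨ +-monoʳ-≤ d spread≤k ⟩
      d + k                            ∎)
      where
      deg∈ : degree G v ∈ degreesIn G B
      deg∈ = ∈-map⁺ (degree G) (∈-filter⁺ (_∈? B) (∈-allFin v) v∈B)

-- Triangulated polygons as binary trees.

-- A triangulated convex polygon with a distinguished side ab: either the
-- degenerate 2-gon ab, or a triangle acb with a polygon glued to each of ac, cb.
infix 5 _∆_
data Triangulation : Set where
  side : Triangulation
  _∆_  : (L R : Triangulation) → Triangulation

-- The two ends of the root side are left out, so that gluing adds only the apex; the polygon has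
-- `2 + inner T` corners.
inner : Triangulation → ℕ
inner side    = 0
inner (L ∆ R) = inner L + suc (inner R)

-- Corners are numbered consecutively; a is the first corner of the root side.
last : Triangulation → ℕ → ℕ
last T a = suc (a + inner T)

Root : Triangulation → ℕ → ℕ → ℕ → Set
Root T a x y = x ≡ a × y ≡ last T a

-- Sides of the polygon count as chords, and each chord runs from its smaller to its larger corner.
-- `last L a` is the apex shared by the two halves.
Chord : Triangulation → ℕ → ℕ → ℕ → Set
Chord side    a x y = Root side a x y
Chord (L ∆ R) a x y = Root (L ∆ R) a x y ⊎ Chord L a x y ⊎ Chord R (last L a) x y

root? : ∀ T a x y → Dec (Root T a x y)
root? T a x y = x ≟ a ×-dec y ≟ last T a

chord? : ∀ T a x y → Dec (Chord T a x y)
chord? side    a x y = root? side a x y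
chord? (L ∆ R) a x y = root? (L ∆ R) a x y ⊎-dec (chord? L a x y ⊎-dec chord? R (last L a) x y)

a<last : ∀ T a → a < last T a
a<last T a = s≤s (m≤m+n a (inner T))

last-∆ : ∀ L R a → last R (last L a) ≡ last (L ∆ R) a
last-∆ L R a = cong suc (trans (cong suc (+-assoc a (inner L) (inner R)))
  (trans (sym (+-suc a _)) (cong (λ s → a + s) (sym (+-suc (inner L) (inner R))))))

last-L< : ∀ L R a → last L a < last (L ∆ R) a
last-L< L R a = subst (last L a <_) (last-∆ L R a) (a<last R (last L a))

chord⇒bounds : ∀ T a {x y} → Chord T a x y → a ≤ x × x < y × y ≤ last T a
chord⇒bounds side a (refl , refl) = ≤-refl , a<last side a , ≤-refl
chord⇒bounds (L ∆ R) a (inj₁ (refl , refl)) = ≤-refl , a<last (L ∆ R) a , ≤-refl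
chord⇒bounds (L ∆ R) a (inj₂ (inj₁ c)) with chord⇒bounds L a c
... | a≤x , x<y , y≤b = a≤x , x<y , ≤-trans y≤b (<⇒≤ (last-L< L R a))
chord⇒bounds (L ∆ R) a (inj₂ (inj₂ c)) with chord⇒bounds R (last L a) c
... | b≤x , x<y , y≤b = ≤-trans (<⇒≤ (a<last L a)) b≤x , x<y , ≤-trans y≤b (≤-reflexive (last-∆ L R a))

chord⇒< : ∀ T a {x y} → Chord T a x y → x < y
chord⇒< T a c = proj₁ (proj₂ (chord⇒bounds T a c))

root-outermost : ∀ T a {x y u v} → Root T a x y → Chord T a u v →
  ¬ (x < u × u < y × y < v) × ¬ (u < x × x < v × v < y)
root-outermost T a (refl , refl) c with chord⇒bounds T a c
... | a≤u , _ , v≤b = (λ (_ , _ , b<v) → <-irrefl refl (<-≤-trans b<v v≤b)) ,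
                      (λ (u<a , _) → <-irrefl refl (<-≤-trans u<a a≤u))

-- Chords from different halves lie in intervals that meet only at the apex, and the root joins the
-- extreme corners, so a crossing would occur within one half.
chords-noncrossing : ∀ T a {x y u v} → Chord T a x y → Chord T a u v → ¬ (x < u × u < y × y < v)
chords-noncrossing side a r c = proj₁ (root-outermost side a r c)
chords-noncrossing (L ∆ R) a (inj₁ r) c = proj₁ (root-outermost (L ∆ R) a r c)
chords-noncrossing (L ∆ R) a c@(inj₂ _) (inj₁ r) = proj₂ (root-outermost (L ∆ R) a r c)
chords-noncrossing (L ∆ R) a (inj₂ (inj₁ c)) (inj₂ (inj₁ c′)) = chords-noncrossing L a c c′
chords-noncrossing (L ∆ R) a (inj₂ (inj₂ c)) (inj₂ (inj₂ c′)) = chords-noncrossing R (last L a) c c′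
chords-noncrossing (L ∆ R) a (inj₂ (inj₁ c)) (inj₂ (inj₂ c′)) (_ , u<y , _) =
  <-irrefl refl (<-≤-trans u<y (≤-trans (proj₂ (proj₂ (chord⇒bounds L a c))) (proj₁ (chord⇒bounds R _ c′))))
chords-noncrossing (L ∆ R) a (inj₂ (inj₂ c)) (inj₂ (inj₁ c′)) (x<u , _ , _) =
  <-irrefl refl (<-≤-trans x<u (≤-trans (<⇒≤ (chord⇒< L a c′))
    (≤-trans (proj₂ (proj₂ (chord⇒bounds L a c′))) (proj₁ (chord⇒bounds R _ c)))))

Adjacent : Triangulation → ℕ → ℕ → Set
Adjacent T x y = Chord T 0 x y ⊎ Chord T 0 y x

adjacent? : ∀ T x y → Dec (Adjacent T x y)
adjacent? T x y = chord? T 0 x y ⊎-dec chord? T 0 y x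

graph : Triangulation → ∀ n → Graph n
graph T n = record
  { _~_      = λ u v → Adjacent T (toℕ u) (toℕ v)
  ; ~-sym    = swap
  ; ~-irrefl = λ { refl (inj₁ c) → <-irrefl refl (chord⇒< T 0 c)
                 ; refl (inj₂ c) → <-irrefl refl (chord⇒< T 0 c) }
  ; _~?_     = λ u v → adjacent? T (toℕ u) (toℕ v)
  }

-- Degrees in a triangulation.

leftDegree rightDegree : Triangulation → ℕ
leftDegree side     = 1
leftDegree (L ∆ R)  = suc (leftDegree L)
rightDegree side    = 1
rightDegree (L ∆ R) = suc (rightDegree R)

-- Degree sums evaluated on the tree, without corner numbers. The root side misses the apex, so the
-- degree there is the sum of its degrees in the two halves.
innerSum total : (ℕ → ℕ) → Triangulation → ℕ
innerSum f side    = 0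
innerSum f (L ∆ R) = innerSum f L + (f (rightDegree L + leftDegree R) + innerSum f R)
total f T = f (leftDegree T) + (innerSum f T + f (rightDegree T))

ends : Triangulation → ℕ → ℕ → ℕ
ends T a x = ind (x ≟ a) + ind (x ≟ last T a)

deg : Triangulation → ℕ → ℕ → ℕ
deg side    a x = ends side a x
deg (L ∆ R) a x = ends (L ∆ R) a x + (deg L a x + deg R (last L a) x)

ends-outside : ∀ T a {x} → x < a ⊎ last T a < x → ends T a x ≡ 0
ends-outside T a {x} (inj₁ x<a) = cong₂ _+_ (ind-no (x ≟ a) (<⇒≢ x<a)) (ind-no (x ≟ _) (<⇒≢ (<-trans x<a (a<last T a))))
ends-outside T a {x} (inj₂ b<x) = cong₂ _+_ (ind-no (x ≟ a) (>⇒≢ (<-trans (a<last T a) b<x))) (ind-no (x ≟ _) (>⇒≢ b<x))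

deg-outside : ∀ T a {x} → x < a ⊎ last T a < x → deg T a x ≡ 0
deg-outside side    a out = ends-outside side a out
deg-outside (L ∆ R) a out@(inj₁ x<a) = cong₂ _+_ (ends-outside (L ∆ R) a out)
  (cong₂ _+_ (deg-outside L a (inj₁ x<a)) (deg-outside R _ (inj₁ (<-trans x<a (a<last L a)))))
deg-outside (L ∆ R) a {x} out@(inj₂ b<x) = cong₂ _+_ (ends-outside (L ∆ R) a out)
  (cong₂ _+_ (deg-outside L a (inj₂ (<-trans (last-L< L R a) b<x)))
             (deg-outside R _ (inj₂ (subst (_< x) (sym (last-∆ L R a)) b<x))))

ends-inside : ∀ T a {x} → a < x → x < last T a → ends T a x ≡ 0
ends-inside T a {x} a<x x<b = cong₂ _+_ (ind-no (x ≟ a) (>⇒≢ a<x)) (ind-no (x ≟ _) (<⇒≢ x<b))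

ends-left : ∀ T a → ends T a a ≡ 1
ends-left T a = cong₂ _+_ (ind-yes (a ≟ a) refl) (ind-no (a ≟ _) (<⇒≢ (a<last T a)))

ends-right : ∀ T a → ends T a (last T a) ≡ 1
ends-right T a = cong₂ _+_ (ind-no (last T a ≟ a) (>⇒≢ (a<last T a))) (ind-yes (last T a ≟ _) refl)

deg-left : ∀ T a → deg T a a ≡ leftDegree T
deg-left side    a = ends-left side a
deg-left (L ∆ R) a = cong₂ _+_ (ends-left (L ∆ R) a)
  (trans (cong₂ _+_ (deg-left L a) (deg-outside R _ (inj₁ (a<last L a)))) (+-identityʳ _))

deg-right : ∀ T a → deg T a (last T a) ≡ rightDegree T
deg-right side    a = ends-right side a
deg-right (L ∆ R) a = cong₂ _+_ (ends-right (L ∆ R) a)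
  (cong₂ _+_ (deg-outside L a (inj₂ (last-L< L R a)))
    (trans (cong (deg R (last L a)) (sym (last-∆ L R a))) (deg-right R (last L a))))

deg-∆ : ∀ L R a {x} → a < x → x < last (L ∆ R) a → deg (L ∆ R) a x ≡ deg L a x + deg R (last L a) x
deg-∆ L R a {x} a<x x<b = cong (_+ (deg L a x + deg R (last L a) x)) (ends-inside (L ∆ R) a a<x x<b)

rangeSum : (ℕ → ℕ) → ℕ → ℕ → ℕ
rangeSum g a zero    = 0
rangeSum g a (suc n) = g a + rangeSum g (suc a) n

rangeSum-split : ∀ g a m n → rangeSum g a (m + n) ≡ rangeSum g a m + rangeSum g (a + m) n
rangeSum-split g a zero    n = cong (λ b → rangeSum g b n) (sym (+-identityʳ a))
rangeSum-split g a (suc m) n = trans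
  (cong (λ s → g a + s) (trans (rangeSum-split g (suc a) m n) (cong (λ b → rangeSum g (suc a) m + rangeSum g b n) (sym (+-suc a m)))))
  (sym (+-assoc (g a) _ _))

rangeSum-cong : ∀ g h a n → (∀ {x} → a ≤ x → x < a + n → g x ≡ h x) → rangeSum g a n ≡ rangeSum h a n
rangeSum-cong g h a zero    g≡h = refl
rangeSum-cong g h a (suc n) g≡h = cong₂ _+_ (g≡h ≤-refl (m<m+n a z<s))
  (rangeSum-cong g h (suc a) n (λ {x} a<x x<b → g≡h (<⇒≤ a<x) (subst (x <_) (sym (+-suc a n)) x<b)))

sum-toℕ : ∀ n a g {h : Fin n → ℕ} → (∀ i → h i ≡ g (a + toℕ i)) → sum h ≡ rangeSum g a n
sum-toℕ zero    a g h≡g = refl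
sum-toℕ (suc n) a g h≡g = cong₂ _+_ (trans (h≡g zero) (cong g (+-identityʳ a)))
  (sum-toℕ n (suc a) g (λ i → trans (h≡g (suc i)) (cong g (+-suc a (toℕ i)))))

-- Corners strictly inside one half keep their degree there, since neither the root nor the other
-- half reaches them; only the apex combines two degrees.
rangeSum-deg : ∀ f T a → rangeSum (f ∘ deg T a) (suc a) (inner T) ≡ innerSum f T
rangeSum-deg f side    a = refl
rangeSum-deg f (L ∆ R) a = begin
  rangeSum g (suc a) (inner L + suc (inner R))
    ≡⟨ rangeSum-split g (suc a) (inner L) (suc (inner R)) ⟩
  rangeSum g (suc a) (inner L) + (g b + rangeSum g (suc b) (inner R))
    ≡⟨ cong₂ (λ p q → p + (g b + q))
         (rangeSum-cong g _ (suc a) (inner L) (λ a<x x<b → cong f (inL a<x x<b)))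
         (rangeSum-cong g _ (suc b) (inner R) (λ b<x x<c → cong f (inR b<x x<c))) ⟩
  rangeSum (f ∘ deg L a) (suc a) (inner L) + (g b + rangeSum (f ∘ deg R b) (suc b) (inner R))
    ≡⟨ cong₂ (λ p q → p + (g b + q)) (rangeSum-deg f L a) (rangeSum-deg f R b) ⟩
  innerSum f L + (g b + innerSum f R)
    ≡⟨ cong (λ d → innerSum f L + (f d + innerSum f R)) atApex ⟩
  innerSum f (L ∆ R) ∎
  where
  open ≡-Reasoning
  g = f ∘ deg (L ∆ R) a
  b = last L a
  inL : ∀ {x} → a < x → x < b → deg (L ∆ R) a x ≡ deg L a x
  inL a<x x<b = trans (deg-∆ L R a a<x (<-trans x<b (last-L< L R a)))
    (trans (cong (λ s → deg L a _ + s) (deg-outside R b (inj₁ x<b))) (+-identityʳ _))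
  inR : ∀ {x} → b < x → x < last R b → deg (L ∆ R) a x ≡ deg R b x
  inR {x} b<x x<c = trans (deg-∆ L R a (<-trans (a<last L a) b<x) (subst (x <_) (last-∆ L R a) x<c))
    (cong (_+ deg R b _) (deg-outside L a (inj₂ b<x)))
  atApex : deg (L ∆ R) a b ≡ rightDegree L + leftDegree R
  atApex = trans (deg-∆ L R a (a<last L a) (last-L< L R a)) (cong₂ _+_ (deg-right L a) (deg-left R b))

sum-deg : ∀ f T → sum {2 + inner T} (λ i → f (deg T 0 (toℕ i))) ≡ total f T
sum-deg f T = begin
  sum {2 + inner T} (λ i → f (deg T 0 (toℕ i)))       ≡⟨ sum-toℕ (2 + inner T) 0 g (λ _ → refl) ⟩
  g 0 + rangeSum g 1 (suc (inner T))                  ≡⟨ cong (λ n → g 0 + rangeSum g 1 n) (+-comm 1 (inner T)) ⟩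
  g 0 + rangeSum g 1 (inner T + 1)                    ≡⟨ cong (λ s → g 0 + s) (rangeSum-split g 1 (inner T) 1) ⟩
  g 0 + (rangeSum g 1 (inner T) + (g (last T 0) + 0)) ≡⟨ cong₂ (λ p q → g 0 + (p + q)) (rangeSum-deg f T 0) (+-identityʳ _) ⟩
  g 0 + (innerSum f T + g (last T 0))                 ≡⟨ cong₂ (λ p q → f p + (innerSum f T + f q)) (deg-left T 0) (deg-right T 0) ⟩
  total f T                                           ∎
  where
  open ≡-Reasoning
  g = f ∘ deg T 0

sum-ind-≟ : ∀ {n b} → b < n → sum {n} (λ i → ind (toℕ i ≟ b)) ≡ 1
sum-ind-≟ {suc n} {zero}  _       = cong suc (sum-replicate-zero n)
sum-ind-≟ {suc n} {suc b} (s≤s b<n) = sum-ind-≟ b<n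

sum-root : ∀ T a x {n} → last T a < n →
  sum {n} (λ i → ind (root? T a x (toℕ i)) + ind (root? T a (toℕ i) x)) ≡ ends T a x
sum-root T a x {n} b<n = begin
  sum {n} (λ i → ind (root? T a x (toℕ i)) + ind (root? T a (toℕ i) x))
    ≡⟨ sum-cong-≗ {n} (λ i → cong₂ _+_ (ind-× (x ≟ a) (toℕ i ≟ last T a))
         (trans (ind-× (toℕ i ≟ a) (x ≟ last T a)) (*-comm (ind (toℕ i ≟ a)) _))) ⟩
  sum {n} (λ i → ind (x ≟ a) * ind (toℕ i ≟ last T a) + ind (x ≟ last T a) * ind (toℕ i ≟ a))
    ≡⟨ ∑-distrib-+ {n} (λ i → ind (x ≟ a) * ind (toℕ i ≟ last T a)) (λ i → ind (x ≟ last T a) * ind (toℕ i ≟ a)) ⟩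
  _ ≡⟨ cong₂ _+_ (at (ind (x ≟ a)) b<n) (at (ind (x ≟ last T a)) (<-trans (a<last T a) b<n)) ⟩
  ends T a x ∎
  where
  open ≡-Reasoning
  at : ∀ c {b} → b < n → sum {n} (λ i → c * ind (toℕ i ≟ b)) ≡ c
  at c b<n = trans (sym (*-distribˡ-sum {n} c _)) (trans (cong (c *_) (sum-ind-≟ b<n)) (*-identityʳ c))

-- Every chord is counted once: the root exceeds any chord of a half, and no chord fits in both
-- halves, which share only the apex.
ind-chord-∆ : ∀ L R a x y → ind (chord? (L ∆ R) a x y) ≡
  ind (root? (L ∆ R) a x y) + (ind (chord? L a x y) + ind (chord? R (last L a) x y))
ind-chord-∆ L R a x y = trans
  (ind-⊎ (root? (L ∆ R) a x y) (chord? L a x y ⊎-dec chord? R (last L a) x y) λ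
    { (refl , refl) (inj₁ c) → <⇒≱ (last-L< L R a) (proj₂ (proj₂ (chord⇒bounds L a c)))
    ; (refl , refl) (inj₂ c) → <⇒≱ (a<last L a) (proj₁ (chord⇒bounds R _ c)) })
  (cong (λ s → ind (root? (L ∆ R) a x y) + s) (ind-⊎ (chord? L a x y) (chord? R (last L a) x y) λ c c′ →
    <⇒≱ (<-≤-trans (chord⇒< L a c) (proj₂ (proj₂ (chord⇒bounds L a c)))) (proj₁ (chord⇒bounds R _ c′))))

sum-chord : ∀ T a x {n} → last T a < n →
  sum {n} (λ i → ind (chord? T a x (toℕ i)) + ind (chord? T a (toℕ i) x)) ≡ deg T a x
sum-chord side    a x b<n = sum-root side a x b<n
sum-chord (L ∆ R) a x {n} b<n = begin
  sum {n} (λ i → ind (chord? (L ∆ R) a x (toℕ i)) + ind (chord? (L ∆ R) a (toℕ i) x))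
    ≡⟨ sum-cong-≗ {n} (λ i → trans (cong₂ _+_ (ind-chord-∆ L R a x (toℕ i)) (ind-chord-∆ L R a (toℕ i) x))
         (interchange (ind (root? (L ∆ R) a x (toℕ i))) (ind (chord? L a x (toℕ i))) (ind (chord? R (last L a) x (toℕ i)))
           (ind (root? (L ∆ R) a (toℕ i) x)) (ind (chord? L a (toℕ i) x)) (ind (chord? R (last L a) (toℕ i) x)))) ⟩
  sum {n} (λ i → ρ i + (l i + r i))
    ≡⟨ trans (∑-distrib-+ {n} ρ (λ i → l i + r i)) (cong (λ s → sum ρ + s) (∑-distrib-+ {n} l r)) ⟩
  sum ρ + (sum l + sum r)
    ≡⟨ cong₂ _+_ (sum-root (L ∆ R) a x b<n) (cong₂ _+_ (sum-chord L a x (<-trans (last-L< L R a) b<n))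
         (sum-chord R (last L a) x (subst (_< n) (sym (last-∆ L R a)) b<n))) ⟩
  deg (L ∆ R) a x ∎
  where
  open ≡-Reasoning
  ρ l r : Fin n → ℕ
  ρ i = ind (root? (L ∆ R) a x (toℕ i)) + ind (root? (L ∆ R) a (toℕ i) x)
  l i = ind (chord? L a x (toℕ i)) + ind (chord? L a (toℕ i) x)
  r i = ind (chord? R (last L a) x (toℕ i)) + ind (chord? R (last L a) (toℕ i) x)
  interchange : ∀ p q r s t u → (p + (q + r)) + (s + (t + u)) ≡ (p + s) + ((q + t) + (r + u))
  interchange = solve-∀

sum-adjacent : ∀ T x → sum {2 + inner T} (λ i → ind (adjacent? T x (toℕ i))) ≡ deg T 0 x
sum-adjacent T x = trans
  (sum-cong-≗ {2 + inner T} (λ i → ind-⊎ (chord? T 0 x (toℕ i)) (chord? T 0 (toℕ i) x) λ c c′ → <-asym (chord⇒< T 0 c) (chord⇒< T 0 c′)))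
  (sum-chord T 0 x ≤-refl)

-- Completing a non-crossing graph to a triangulation.

-- Index 0 is the fallback when no index satisfies `P`; in `triangulate` it stands for the corner
-- next to `a`.
greatest : ∀ {P : ℕ → Set} → (∀ i → Dec (P i)) → ∀ m →
  ∃[ i ] i ≤ m × (i ≡ 0 ⊎ P i) × (∀ {j} → i < j → j ≤ m → ¬ P j)
greatest P? zero    = 0 , z≤n , inj₁ refl , λ { () z≤n }
greatest P? (suc m) with P? (suc m)
... | yes p = suc m , ≤-refl , inj₂ p , λ m<j j≤m _ → <⇒≱ m<j j≤m
... | no ¬p with greatest P? m
...   | i , i≤m , Pi , P> = i , m≤n⇒m≤1+n i≤m , Pi , λ i<j j≤m p → case-≤ i<j (m≤n⇒m<n∨m≡n j≤m) p
  where
  case-≤ : ∀ {j} → i < j → j < suc m ⊎ j ≡ suc m → ¬ _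
  case-≤ i<j (inj₁ (s≤s j≤m)) = P> i<j j≤m
  case-≤ i<j (inj₂ refl)      = ¬p

module _ {_↔_ : ℕ → ℕ → Set} (_↔?_ : ∀ x y → Dec (x ↔ y))
         (noncrossing : ∀ {x y u v} → x ↔ y → u ↔ v → ¬ (x < u × u < y × y < v)) where

  -- The triangle on the root side a b gets its apex at the neighbour of a
  -- farthest along the way to b (or at a + 1): no chord can then separate the
  -- apex from ab.
  triangulate : ∀ k m a → m < k → ∃[ T ] inner T ≡ m ×
    (∀ {x y} → a ≤ x → x < y → y ≤ suc (a + m) → x ↔ y → Chord T a x y)
  triangulate (suc k) zero    a _   = side , refl , λ {x} {y} a≤x x<y y≤b _ →
    ≤-antisym (s≤s⁻¹ (≤-trans x<y (subst (y ≤_) (cong suc (+-identityʳ a)) y≤b))) a≤x ,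
    ≤-antisym y≤b (≤-trans (s≤s (≤-trans (≤-reflexive (+-identityʳ a)) a≤x)) x<y)
  -- `k` is fuel: the halves have `i` and `m ∸ i` inner corners, both at most `m`. The search stops
  -- one corner before the far end of the root side.
  triangulate (suc k) (suc m) a (s≤s m<k) with greatest (λ i → a ↔? suc (a + i)) m
  ... | i , i≤m , farthest , beyond
    with triangulate k i a (≤-<-trans i≤m m<k) | triangulate k (m ∸ i) (suc (a + i)) (≤-<-trans (m∸n≤m m i) m<k)
  ...   | L , refl , coverL | R , innerR , coverR = L ∆ R , inner≡ , cover
    where
    c = suc (a + inner L)
    inner≡ : inner L + suc (inner R) ≡ suc m
    inner≡ = trans (+-suc _ _) (cong suc (trans (cong (λ s → inner L + s) innerR) (m+[n∸m]≡n i≤m)))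
    last≡ : suc (c + (m ∸ inner L)) ≡ suc (a + suc m)
    last≡ = cong suc (trans (cong suc (trans (+-assoc a _ _) (cong (λ s → a + s) (m+[n∸m]≡n i≤m)))) (sym (+-suc a m)))
    -- An edge over `c` that starts strictly between `a` and `c` crosses the edge from `a` to `c`;
    -- if `c` is the fallback `a + 1`, it has no room to start.
    unseparated : ∀ {x y} → a < x → x < c → c < y → x ↔ y → ¬ (inner L ≡ 0 ⊎ a ↔ c)
    unseparated a<x x<c c<y x↔y (inj₁ i≡0) = <⇒≱ (subst (λ i → _ < suc (a + i)) i≡0 x<c) (subst (_< _) (sym (+-identityʳ a)) a<x)
    unseparated a<x x<c c<y x↔y (inj₂ a↔c) = noncrossing a↔c x↔y (a<x , x<c , c<y)
    cover : ∀ {x y} → a ≤ x → x < y → y ≤ suc (a + suc m) → x ↔ y → Chord (L ∆ R) a x y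
    cover {x} {y} a≤x x<y y≤b x↔y with y ≤? c | c ≤? x
    ... | yes y≤c | _ = inj₂ (inj₁ (coverL a≤x x<y y≤c x↔y))
    ... | no  _   | yes c≤x = inj₂ (inj₂ (coverR c≤x x<y (subst (y ≤_) (sym last≡) y≤b) x↔y))
    ... | no  y≰c | no c≰x with m≤n⇒m<n∨m≡n a≤x | m≤n⇒m<n∨m≡n y≤b
    ...   | inj₂ refl | inj₂ y≡b = inj₁ (refl , trans y≡b (cong (λ m → suc (a + m)) (sym inner≡)))
    -- An edge from `a` beyond `c`, short of the far end, contradicts the choice of the farthest
    -- neighbour.
    ...   | inj₂ refl | inj₁ (s≤s y<b) = contradiction (subst (a ↔_) (sym y≡) x↔y) (beyond i<j j≤m)
      where
      j = y ∸ suc a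
      y≡ : suc (a + j) ≡ y
      y≡ = m+[n∸m]≡n x<y
      i<j : inner L < j
      i<j = +-cancelˡ-< (suc a) _ _ (subst (c <_) (sym y≡) (≰⇒> y≰c))
      j≤m : j ≤ m
      j≤m = +-cancelˡ-≤ (suc a) _ _ (subst₂ _≤_ (sym y≡) (+-suc a m) y<b)
    ...   | inj₁ a<x | _ = contradiction farthest (unseparated a<x (≰⇒> c≰x) (≰⇒> y≰c) x↔y)

-- Maximal outerplanar graphs as triangulations.

Covers : ∀ {n} → Triangulation → Graph n → Permutation′ n → Set
Covers T G π = ∀ {u v} → u ~ v → π ⟨$⟩ʳ u Fin.< π ⟨$⟩ʳ v → Chord T 0 (toℕ (π ⟨$⟩ʳ u)) (toℕ (π ⟨$⟩ʳ v))
  where open Graph G using (_~_)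

noncrossing⇒covers : ∀ {m} (G : Graph (2 + m)) π → NonCrossing G π → ∃[ T ] inner T ≡ m × Covers T G π
noncrossing⇒covers {m} G π nc with triangulate drawn? drawn-noncrossing (suc m) m 0 ≤-refl
  where
  open Graph G using (_~_; _~?_)
  Drawn : ℕ → ℕ → Set
  Drawn x y = ∃[ u ] ∃[ v ] toℕ (π ⟨$⟩ʳ u) ≡ x × toℕ (π ⟨$⟩ʳ v) ≡ y × u ~ v
  drawn? : ∀ x y → Dec (Drawn x y)
  drawn? x y = Fin.any? λ u → Fin.any? λ v → toℕ (π ⟨$⟩ʳ u) ≟ x ×-dec (toℕ (π ⟨$⟩ʳ v) ≟ y ×-dec u ~? v)
  drawn-noncrossing : ∀ {x y u v} → Drawn x y → Drawn u v → ¬ (x < u × u < y × y < v)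
  drawn-noncrossing (_ , _ , refl , refl , e) (_ , _ , refl , refl , e′) = nc e e′
... | T , innerT , cover = T , innerT , λ {u} {v} e u<v → cover z≤n u<v (s≤s⁻¹ (Fin.toℕ<n (π ⟨$⟩ʳ v))) (u , v , refl , refl , e)

covers⇒noncrossing : ∀ {n} T (G : Graph n) π → Covers T G π → NonCrossing G π
covers⇒noncrossing T G π cover e e′ cross@(u<x , x<v , v<y) =
  chords-noncrossing T 0 (cover e (<-trans u<x x<v)) (cover e′ (<-trans x<v v<y)) cross

position-injective : ∀ {n} (π : Permutation′ n) {u v} → π ⟨$⟩ʳ u ≡ π ⟨$⟩ʳ v → u ≡ v
position-injective π eq = trans (sym (inverseˡ π)) (trans (cong (π Perm.⟨$⟩ˡ_) eq) (inverseˡ π))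

covers⇒adjacent : ∀ {n} T (G : Graph n) π → Covers T G π → ∀ {u v} → Graph._~_ G u v →
  Adjacent T (toℕ (π ⟨$⟩ʳ u)) (toℕ (π ⟨$⟩ʳ v))
covers⇒adjacent T G π cover {u} {v} e with Fin.<-cmp (π ⟨$⟩ʳ u) (π ⟨$⟩ʳ v)
... | tri< u<v _ _ = inj₁ (cover e u<v)
... | tri≈ _ u≡v _ = contradiction e (Graph.~-irrefl G (position-injective π u≡v))
... | tri> _ _ v<u = inj₂ (cover (Graph.~-sym G e) v<u)

sum-adjacent-π : ∀ T (π : Permutation′ (2 + inner T)) x →
  sum (λ w → ind (adjacent? T x (toℕ (π ⟨$⟩ʳ w)))) ≡ deg T 0 x
sum-adjacent-π T π x = trans (sym (sum-permute (λ i → ind (adjacent? T x (toℕ i))) π)) (sum-adjacent T x)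

sum-deg-π : ∀ f T (π : Permutation′ (2 + inner T)) →
  sum (λ v → f (deg T 0 (toℕ (π ⟨$⟩ʳ v)))) ≡ total f T
sum-deg-π f T π = trans (sym (sum-permute (λ i → f (deg T 0 (toℕ i))) π)) (sum-deg f T)

-- With `total-id` this bounds the degree sum of an outerplanar graph of order n by 4n - 6, twice
-- the edges of a triangulation.
covers⇒sum-degree≤ : ∀ T (G : Graph (2 + inner T)) π → Covers T G π → sum (degree G) ≤ total id T
covers⇒sum-degree≤ T G π cover = ≤-trans (sum-mono (degree G) _ degree≤) (≤-reflexive (sum-deg-π id T π))
  where
  open ≤-Reasoning
  degree≤ : ∀ v → degree G v ≤ deg T 0 (toℕ (π ⟨$⟩ʳ v))
  degree≤ v = begin
    degree G v                                                      ≡⟨ degree-sum G v ⟩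
    sum (λ w → ind (Graph._~?_ G v w))                              ≤⟨ sum-mono _ _ (λ w → ind-mono (Graph._~?_ G v w) (adjacent? T _ _) (covers⇒adjacent T G π cover)) ⟩
    sum (λ w → ind (adjacent? T (toℕ (π ⟨$⟩ʳ v)) (toℕ (π ⟨$⟩ʳ w)))) ≡⟨ sum-adjacent-π T π _ ⟩
    deg T 0 (toℕ (π ⟨$⟩ʳ v))                                        ∎

sum-over-degrees : ∀ f T (G : Graph (2 + inner T)) π → Covers T G π →
  (∀ {u v} → Chord T 0 (toℕ (π ⟨$⟩ʳ u)) (toℕ (π ⟨$⟩ʳ v)) → Graph._~_ G u v) →
  sum (λ v → f (degree G v)) ≡ total f T
sum-over-degrees f T G π cover chord⇒edge = trans (sum-cong-≗ (cong f ∘ degree≡)) (sum-deg-π f T π)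
  where
  adjacent⇒edge : ∀ {u v} → Adjacent T (toℕ (π ⟨$⟩ʳ u)) (toℕ (π ⟨$⟩ʳ v)) → Graph._~_ G u v
  adjacent⇒edge (inj₁ c) = chord⇒edge c
  adjacent⇒edge (inj₂ c) = Graph.~-sym G (chord⇒edge c)
  degree≡ : ∀ v → degree G v ≡ deg T 0 (toℕ (π ⟨$⟩ʳ v))
  degree≡ v = trans (degree-sum G v) (trans
    (sum-cong-≗ (λ w → ind-cong (Graph._~?_ G v w) (adjacent? T _ _) (covers⇒adjacent T G π cover) adjacent⇒edge))
    (sum-adjacent-π T π _))

-- A chord of the covering triangulation missing from `G` could be added and the result would still
-- be covered, hence free of crossings, against maximality.
MOP⇒covers : ∀ {m} (G : Graph (2 + m)) → IsMOP G → ∃[ T ] inner T ≡ m × ∃[ π ] Covers T G π ×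
  (∀ {u v} → Chord T 0 (toℕ (π ⟨$⟩ʳ u)) (toℕ (π ⟨$⟩ʳ v)) → Graph._~_ G u v)
MOP⇒covers G mop with IsMOP.outerplanar mop
... | π , nc with noncrossing⇒covers G π nc
...   | T , innerT , cover = T , innerT , π , cover , chord⇒edge
  where
  open Graph G using (_~_; _~?_)
  chord⇒edge : ∀ {u v} → Chord T 0 (toℕ (π ⟨$⟩ʳ u)) (toℕ (π ⟨$⟩ʳ v)) → u ~ v
  chord⇒edge {u} {v} c = decidable-stable (u ~? v) λ ¬e →
    IsMOP.maximal mop u≢v ¬e (π , covers⇒noncrossing T (addEdge G u≢v) π cover′)
    where
    u≢v : u ≢ v
    u≢v refl = <-irrefl refl (chord⇒< T 0 c)
    cover′ : Covers T (addEdge G u≢v) π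
    cover′ (inj₁ e) x<y = cover e x<y
    cover′ (inj₂ (inj₁ (refl , refl))) _ = c
    cover′ (inj₂ (inj₂ (refl , refl))) v<u = contradiction (chord⇒< T 0 c) (<-asym v<u)

graph-covers : ∀ T n → Covers T (graph T n) Perm.id
graph-covers T n (inj₁ c) _   = c
graph-covers T n (inj₂ c) u<v = contradiction (chord⇒< T 0 c) (<-asym u<v)

graph-sum : ∀ f T → sum (λ v → f (degree (graph T (2 + inner T)) v)) ≡ total f T
graph-sum f T = sum-over-degrees f T (graph T _) Perm.id (graph-covers T _) inj₁

-- This is twice 2n - 3 for n = `2 + inner T`. Gluing merges two corners into the apex, and the new
-- root side adds one at each of its ends.
total-id : ∀ T → total id T ≡ 2 + 4 * inner T
total-id side    = refl
total-id (L ∆ R) = begin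
  suc (leftDegree L) + ((innerSum id L + (rightDegree L + leftDegree R + innerSum id R)) + suc (rightDegree R))
    ≡⟨ regroup (leftDegree L) (innerSum id L) (rightDegree L) (leftDegree R) (innerSum id R) (rightDegree R) ⟩
  2 + (total id L + total id R)
    ≡⟨ cong₂ (λ p q → 2 + (p + q)) (total-id L) (total-id R) ⟩
  2 + ((2 + 4 * inner L) + (2 + 4 * inner R))
    ≡⟨ collect (inner L) (inner R) ⟩
  2 + 4 * (inner L + suc (inner R)) ∎
  where
  open ≡-Reasoning
  regroup : ∀ a b c d e f → suc a + ((b + (c + d + e)) + suc f) ≡ 2 + ((a + (b + c)) + (d + (e + f)))
  regroup = solve-∀
  collect : ∀ a b → 2 + ((2 + 4 * a) + (2 + 4 * b)) ≡ 2 + 4 * (a + suc b)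
  collect = solve-∀

-- Maximality is edge counting: every outerplanar graph on these vertices has at most as many edges.
graph-isMOP : ∀ T → IsMOP (graph T (2 + inner T))
graph-isMOP T = record
  { outerplanar = Perm.id , covers⇒noncrossing T G Perm.id (graph-covers T _)
  ; maximal     = maximal
  }
  where
  n = 2 + inner T
  G = graph T n
  open Graph G using (_~_; _~?_)
  open ≤-Reasoning
  maximal : ∀ {u v} (u≢v : u ≢ v) → ¬ (u ~ v) → ¬ Outerplanar (addEdge G u≢v)
  maximal {u} {v} u≢v ¬e (π , nc) with noncrossing⇒covers (addEdge G u≢v) π nc
  ... | T′ , innerT′ , cover = <-irrefl refl (begin-strict
    sum (degree G)  <⟨ sum-mono-< (degree G) (degree G⁺) degree≤ u degree< ⟩
    sum (degree G⁺) ≤⟨ bound T′ innerT′ G⁺ π cover ⟩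
    2 + 4 * inner T ≡⟨ total-id T ⟨
    total id T      ≡⟨ graph-sum id T ⟨
    sum (degree G)  ∎)
    where
    G⁺ = addEdge G u≢v
    -- The order is a variable here so that `refl` can identify it with that of `T′`.
    bound : ∀ {m} T′ → inner T′ ≡ m → (H : Graph (2 + m)) → ∀ π → Covers T′ H π → sum (degree H) ≤ 2 + 4 * m
    bound T′ refl H π cover = ≤-trans (covers⇒sum-degree≤ T′ H π cover) (≤-reflexive (total-id T′))
    row row⁺ : Fin n → Fin n → ℕ
    row  x y = ind (x ~? y)
    row⁺ x y = ind (Graph._~?_ G⁺ x y)
    row≤ : ∀ x y → row x y ≤ row⁺ x y
    row≤ x y = ind-mono (x ~? y) (Graph._~?_ G⁺ x y) inj₁
    degree≤ : ∀ x → degree G x ≤ degree G⁺ x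
    degree≤ x = subst₂ _≤_ (sym (degree-sum G x)) (sym (degree-sum G⁺ x)) (sum-mono (row x) (row⁺ x) (row≤ x))
    degree< : degree G u < degree G⁺ u
    degree< = subst₂ _<_ (sym (degree-sum G u)) (sym (degree-sum G⁺ u)) (sum-mono-< (row u) (row⁺ u) (row≤ u) v (begin-strict
      row u v   ≡⟨ ind-no (u ~? v) ¬e ⟩
      0         <⟨ z<s ⟩
      1         ≡⟨ ind-yes (Graph._~?_ G⁺ u v) (inj₂ (inj₁ (refl , refl))) ⟨
      row⁺ u v  ∎))

-- Linearity and monotonicity of degree sums.

innerSum-+ : ∀ f g T → innerSum (λ d → f d + g d) T ≡ innerSum f T + innerSum g T
innerSum-+ f g side    = refl
innerSum-+ f g (L ∆ R) = trans
  (cong₂ (λ p q → p + (f d + g d + q)) (innerSum-+ f g L) (innerSum-+ f g R))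
  (regroup (innerSum f L) (innerSum g L) (f d) (g d) (innerSum f R) (innerSum g R))
  where
  d = rightDegree L + leftDegree R
  regroup : ∀ a b c d e f → (a + b) + (c + d + (e + f)) ≡ (a + (c + e)) + (b + (d + f))
  regroup = solve-∀

total-+ : ∀ f g T → total (λ d → f d + g d) T ≡ total f T + total g T
total-+ f g T = trans
  (cong (λ s → f l + g l + (s + (f r + g r))) (innerSum-+ f g T))
  (regroup (f l) (g l) (innerSum f T) (innerSum g T) (f r) (g r))
  where
  l = leftDegree T
  r = rightDegree T
  regroup : ∀ a b c d e f → (a + b) + ((c + d) + (e + f)) ≡ (a + (c + e)) + (b + (d + f))
  regroup = solve-∀

innerSum-* : ∀ c f T → innerSum (λ d → c * f d) T ≡ c * innerSum f T
innerSum-* c f side    = sym (*-zeroʳ c)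
innerSum-* c f (L ∆ R) = trans
  (cong₂ (λ p q → p + (c * f d + q)) (innerSum-* c f L) (innerSum-* c f R))
  (factor c (innerSum f L) (f d) (innerSum f R))
  where
  d = rightDegree L + leftDegree R
  factor : ∀ k a b c → k * a + (k * b + k * c) ≡ k * (a + (b + c))
  factor = solve-∀

total-* : ∀ c f T → total (λ d → c * f d) T ≡ c * total f T
total-* c f T = trans
  (cong (λ s → c * f l + (s + c * f r)) (innerSum-* c f T))
  (factor c (f l) (innerSum f T) (f r))
  where
  l = leftDegree T
  r = rightDegree T
  factor : ∀ k a b c → k * a + (k * b + k * c) ≡ k * (a + (b + c))
  factor = solve-∀

innerSum-const : ∀ c T → innerSum (λ _ → c) T ≡ c * inner T
innerSum-const c side    = sym (*-zeroʳ c)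
innerSum-const c (L ∆ R) = trans
  (cong₂ (λ p q → p + (c + q)) (innerSum-const c L) (innerSum-const c R))
  (collect c (inner L) (inner R))
  where
  collect : ∀ c a b → c * a + (c + c * b) ≡ c * (a + suc b)
  collect = solve-∀

total-const : ∀ c T → total (λ _ → c) T ≡ c * (2 + inner T)
total-const c T = trans (cong (λ s → c + (s + c)) (innerSum-const c T)) (collect c (inner T))
  where
  collect : ∀ c m → c + (c * m + c) ≡ c * (2 + m)
  collect = solve-∀

1≤leftDegree : ∀ T → 1 ≤ leftDegree T
1≤leftDegree side    = ≤-refl
1≤leftDegree (L ∆ R) = s≤s z≤n

1≤rightDegree : ∀ T → 1 ≤ rightDegree T
1≤rightDegree side    = ≤-refl
1≤rightDegree (L ∆ R) = s≤s z≤n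

module _ {f g : ℕ → ℕ} (f≤g : ∀ {d} → 2 ≤ d → f d ≤ g d) where

  innerSum-mono : ∀ T → innerSum f T ≤ innerSum g T
  innerSum-mono side    = z≤n
  innerSum-mono (L ∆ R) = +-mono-≤ (innerSum-mono L)
    (+-mono-≤ (f≤g (+-mono-≤ (1≤rightDegree L) (1≤leftDegree R))) (innerSum-mono R))

  -- All corners have degree at least 2 once there is a triangle; the ends of a bare `side` have
  -- degree 1.
  total-mono : ∀ T → 1 ≤ inner T → total f T ≤ total g T
  total-mono (L ∆ R) _ = +-mono-≤ (f≤g (s≤s (1≤leftDegree L)))
    (+-mono-≤ (innerSum-mono (L ∆ R)) (f≤g (s≤s (1≤rightDegree R))))

-- Two corners of degree 3 or 4.

-- Two corners of these degrees improve the bound from 4n + 6 to 4n + 10.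
mid : ℕ → ℕ
mid = win 1 3

triangle : Triangulation
triangle = side ∆ side

-- The split is made because exactly the polygons with at least two inner corners have an inner
-- corner of degree 3 or 4.
data Size : Triangulation → Set where
  side  : Size side
  ear   : Size triangle
  large : ∀ {T} → 2 ≤ inner T → Size T

size : ∀ T → Size T
size side = side
size (side ∆ side) = ear
size (side ∆ (L ∆ R)) = large (s≤s (m≤n⇒m≤o+n (inner L) (s≤s z≤n)))
size ((L ∆ R) ∆ S) = large (+-mono-≤ {1} {_} {1} (m≤n⇒m≤o+n (inner L) (s≤s z≤n)) (s≤s z≤n))

-- An apex between two polygons with at most one inner corner each has degree 3 or 4 unless both are sides.
1≤innerSum-mid : ∀ T → 2 ≤ inner T → 1 ≤ innerSum mid T
1≤innerSum-mid (L ∆ R) 2≤ = go (size L) (size R) 2≤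
  where
  d = rightDegree L + leftDegree R
  go : Size L → Size R → 2 ≤ inner (L ∆ R) → 1 ≤ innerSum mid (L ∆ R)
  go (large 2≤L) _           _ = m≤n⇒m≤n+o _ (1≤innerSum-mid L 2≤L)
  go side        (large 2≤R) _ = m≤n⇒m≤o+n (mid d) (1≤innerSum-mid R 2≤R)
  go ear         (large 2≤R) _ = m≤n⇒m≤o+n (mid d) (1≤innerSum-mid R 2≤R)
  go side        side        (s≤s ())
  go side        ear         _ = ≤-refl
  go ear         side        _ = ≤-refl
  go ear         ear         _ = ≤-refl

-- The shift by 2 stands for two chords at the left end of `T` that lie outside `T`. With at most
-- one inner corner in `T` that end has degree 3 or 4; otherwise an inner corner has.
1≤mid-left : ∀ T → 1 ≤ mid (2 + leftDegree T) + innerSum mid T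
1≤mid-left T with size T
... | side      = ≤-refl
... | ear       = ≤-refl
... | large 2≤T = m≤n⇒m≤o+n (mid (2 + leftDegree T)) (1≤innerSum-mid T 2≤T)

1≤mid-right : ∀ T → 1 ≤ mid (2 + rightDegree T) + innerSum mid T
1≤mid-right T with size T
... | side      = ≤-refl
... | ear       = ≤-refl
... | large 2≤T = m≤n⇒m≤o+n (mid (2 + rightDegree T)) (1≤innerSum-mid T 2≤T)

-- If the root triangle is an ear, each half of the triangle behind it provides a corner, inner or
-- at its outer end. Otherwise a large half provides an inner corner, and a half that is an ear
-- gives degree 3 to its end of the root side.
2≤total-mid : ∀ T → 2 ≤ inner T → 2 ≤ total mid T
2≤total-mid (L ∆ R) 2≤ = go L R (size L) (size R) 2≤
  where
  within : ∀ {a b r c} → 1 ≤ a → 1 ≤ b → a + b + r ≡ c → 2 ≤ c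
  within 1≤a 1≤b refl = m≤n⇒m≤n+o _ (+-mono-≤ 1≤a 1≤b)
  go : ∀ L R → Size L → Size R → 2 ≤ inner (L ∆ R) → 2 ≤ total mid (L ∆ R)
  go side side _ _ (s≤s ())
  go side (L ∆ R) _ _ _ = within (1≤mid-left L) (1≤mid-right R)
    (solve 5 (λ a b c d e → (a :+ b) :+ (c :+ d) :+ e := (a :+ ((b :+ (e :+ d))) :+ c)) refl
      (mid (2 + leftDegree L)) (innerSum mid L) (mid (2 + rightDegree R)) (innerSum mid R) (mid (rightDegree L + leftDegree R)))
  go (L ∆ R) side _ _ _ = within (1≤mid-left L)
    (subst (λ d → 1 ≤ mid (suc d) + innerSum mid R) (+-comm 1 (rightDegree R)) (1≤mid-right R))
    (solve 5 (λ a b c d e → (a :+ b) :+ (c :+ d) :+ e := (a :+ (((b :+ (e :+ d)) :+ (c :+ con 0)) :+ con 0))) refl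
      (mid (2 + leftDegree L)) (innerSum mid L) (mid (suc (rightDegree R + 1))) (innerSum mid R) (mid (rightDegree L + leftDegree R)))
  go L R (large 2≤L) (large 2≤R) _ = within (1≤innerSum-mid L 2≤L) (1≤innerSum-mid R 2≤R)
    (outer (mid (1 + leftDegree L)) (innerSum mid L) (mid (rightDegree L + leftDegree R)) (innerSum mid R) (mid (1 + rightDegree R)))
    where
    outer : ∀ a b c d e → b + d + (a + c + e) ≡ a + ((b + (c + d)) + e)
    outer = solve-∀
  go L R ear (large 2≤R) _ = s≤s (m≤n⇒m≤n+o _ (m≤n⇒m≤o+n (mid (2 + leftDegree R)) (1≤innerSum-mid R 2≤R)))
  go L R (large 2≤L) ear _ = within (1≤innerSum-mid L 2≤L) ≤-refl
    (solve 3 (λ a b c → b :+ con 1 :+ (a :+ c) := (a :+ ((b :+ (c :+ con 0)) :+ con 1))) refl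
      (mid (1 + leftDegree L)) (innerSum mid L) (mid (rightDegree L + 2)))
  go L R ear ear _ = ≤ᵇ⇒≤ _ _ tt

-- The lower bound by weighting degree windows.

weight : ℕ → ℕ
weight d = d + (6 * win 2 2 d + (2 * win 2 5 d + win 2 3 d))

-- Equality holds exactly for the degrees 2, 3, 5, 6 and 8, those that the extremal triangulations
-- use. From 8 on the degree alone suffices.
weight≥ : ∀ {d} → 2 ≤ d → 8 + 2 * mid d ≤ weight d
weight≥ {1} (s≤s ())
weight≥ {2} _ = ≤ᵇ⇒≤ _ _ tt
weight≥ {3} _ = ≤ᵇ⇒≤ _ _ tt
weight≥ {4} _ = ≤ᵇ⇒≤ _ _ tt
weight≥ {5} _ = ≤ᵇ⇒≤ _ _ tt
weight≥ {6} _ = ≤ᵇ⇒≤ _ _ tt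
weight≥ {7} _ = ≤ᵇ⇒≤ _ _ tt
weight≥ {suc (suc (suc (suc (suc (suc (suc (suc d)))))))} _ = ≤-trans (m≤m+n 8 d) (m≤m+n (8 + d) _)

-- `weight≥` is summed over all corners; the window coefficients 6, 2 and 1 add up to 9. The windows
-- start at 2, 5 and 3, within reach of `count≤sp` for orders from 5 on.
windows≤⇒order≤ : ∀ T {M} → 2 ≤ inner T → (∀ {d} → d ≤ 5 → total (win 2 d) T ≤ M) →
  4 * (2 + inner T) + 10 ≤ 9 * M
windows≤⇒order≤ T {M} 2≤m window≤M = +-cancelˡ-≤ (4 * n) _ _ (begin
  4 * n + (4 * n + 10)                     ≡⟨ split m ⟩
  -- The 6 completes the degree sum 4n - 6 to 4n and keeps the computation free of subtraction.
  (8 * n + 2 * 2) + 6                      ≤⟨ +-monoˡ-≤ 6 (+-monoʳ-≤ (8 * n) (*-monoʳ-≤ 2 (2≤total-mid T 2≤m))) ⟩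
  (8 * n + 2 * total mid T) + 6            ≡⟨ cong (_+ 6) (trans (total-+ (λ _ → 8) (λ d → 2 * mid d) T) (cong₂ _+_ (total-const 8 T) (total-* 2 mid T))) ⟨
  total (λ d → 8 + 2 * mid d) T + 6        ≤⟨ +-monoˡ-≤ 6 (total-mono weight≥ T (≤-trans (s≤s z≤n) 2≤m)) ⟩
  total weight T + 6                       ≡⟨ cong (_+ 6) total-weight ⟩
  (total id T + (6 * total (win 2 2) T + (2 * total (win 2 5) T + total (win 2 3) T))) + 6
    ≤⟨ +-monoˡ-≤ 6 (+-mono-≤ (≤-reflexive (total-id T)) (+-mono-≤ (*-monoʳ-≤ 6 (window≤M {2} (≤ᵇ⇒≤ _ _ tt)))
         (+-mono-≤ (*-monoʳ-≤ 2 (window≤M {5} ≤-refl)) (window≤M {3} (≤ᵇ⇒≤ _ _ tt))))) ⟩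
  (2 + 4 * m + (6 * M + (2 * M + M))) + 6  ≡⟨ collect m M ⟩
  4 * n + 9 * M                            ∎)
  where
  open ≤-Reasoning
  m = inner T
  n = 2 + m
  total-weight : total weight T ≡ total id T + (6 * total (win 2 2) T + (2 * total (win 2 5) T + total (win 2 3) T))
  total-weight = trans (total-+ id _ T) (cong (λ s → total id T + s) (trans (total-+ (λ d → 6 * win 2 2 d) _ T)
    (cong₂ _+_ (total-* 6 (win 2 2) T) (trans (total-+ (λ d → 2 * win 2 5 d) (win 2 3) T) (cong (_+ total (win 2 3) T) (total-* 2 (win 2 5) T))))))
  split : ∀ m → 4 * (2 + m) + (4 * (2 + m) + 10) ≡ (8 * (2 + m) + 2 * 2) + 6
  split = solve-∀
  collect : ∀ m M → (2 + 4 * m + (6 * M + (2 * M + M))) + 6 ≡ 4 * (2 + m) + 9 * M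
  collect = solve-∀

-- Extremal triangulations and padding with ears.

-- The extremal triangulations: without their ears (the corners of degree 2)
-- they are strips, to which one period adds 8 corners of degree 2, 8 of degree 5
-- and 2 of degree 8.
period : Triangulation → Triangulation
period T =
  ((triangle ∆ (triangle ∆ (triangle ∆ ((((triangle ∆ ((side ∆ T) ∆ side)) ∆ triangle) ∆ triangle) ∆ triangle)))) ∆ triangle)

core : ℕ → Triangulation
core zero    =
  ((triangle ∆ ((side ∆ ((triangle ∆ ((triangle ∆ (triangle ∆ side)) ∆ triangle)) ∆ triangle)) ∆ side)) ∆ triangle)
core (suc j) = period (core j)

extremal : ℕ → Triangulation
extremal zero    = side
extremal (suc j) = side ∆ (side ∆ core j)

-- `period` has end degrees 4 and 3 whatever it encloses, and `innerSum-period` asks for these same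
-- degrees, so periods can be stacked.
leftDegree-core : ∀ j → leftDegree (core j) ≡ 4
leftDegree-core zero    = refl
leftDegree-core (suc j) = refl

rightDegree-core : ∀ j → rightDegree (core j) ≡ 3
rightDegree-core zero    = refl
rightDegree-core (suc j) = refl

innerSum-period : ∀ f T → leftDegree T ≡ 4 → rightDegree T ≡ 3 →
  innerSum f (period T) ≡ innerSum f T + (8 * f 2 + (8 * f 5 + 2 * f 8))
innerSum-period f T l r rewrite l | r =
  -- `o` and `t` are the inner sums of `side` and `triangle`; the expression follows the tree
  -- `period T`.
  solve 4 (λ d2 d5 d8 x → let o = con 0; t = o :+ (d2 :+ o) in
    ((t :+ (d5 :+ (t :+ (d5 :+ (t :+ (d8 :+ ((((t :+ (d5 :+ ((o :+ (d5 :+ x)) :+ (d5 :+ o)))) :+ (d5 :+ t)) :+ (d5 :+ t)) :+ (d5 :+ t)))))))) :+ (d8 :+ t))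
    := x :+ (con 8 :* d2 :+ (con 8 :* d5 :+ con 2 :* d8)))
  refl (f 2) (f 5) (f 8) (innerSum f T)

innerSum-core : ∀ f j → innerSum f (core j) ≡
  (7 + 8 * j) * f 2 + (f 3 + ((6 + 8 * j) * f 5 + (2 * f 6 + 2 * j * f 8)))
innerSum-core f zero =
  solve 4 (λ d2 d3 d5 d6 → let o = con 0; t = o :+ (d2 :+ o) in
    ((t :+ (d5 :+ ((o :+ (d5 :+ ((t :+ (d6 :+ ((t :+ (d5 :+ (t :+ (d3 :+ o)))) :+ (d5 :+ t)))) :+ (d6 :+ t)))) :+ (d5 :+ o)))) :+ (d5 :+ t))
    := con 7 :* d2 :+ (d3 :+ (con 6 :* d5 :+ (con 2 :* d6 :+ o))))
  refl (f 2) (f 3) (f 5) (f 6)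
innerSum-core f (suc j) = begin
  innerSum f (period (core j))
    ≡⟨ innerSum-period f (core j) (leftDegree-core j) (rightDegree-core j) ⟩
  innerSum f (core j) + (8 * f 2 + (8 * f 5 + 2 * f 8))
    ≡⟨ cong (_+ (8 * f 2 + (8 * f 5 + 2 * f 8))) (innerSum-core f j) ⟩
  _ ≡⟨ collect j (f 2) (f 3) (f 5) (f 6) (f 8) ⟩
  _ ∎
  where
  open ≡-Reasoning
  collect : ∀ j a b c d e →
    (7 + 8 * j) * a + (b + ((6 + 8 * j) * c + (2 * d + 2 * j * e))) + (8 * a + (8 * c + 2 * e)) ≡
    (7 + 8 * suc j) * a + (b + ((6 + 8 * suc j) * c + (2 * d + 2 * suc j * e)))
  collect = solve-∀

-- The two triangles put on `core j` raise its ends to degree 5 and add one corner of degree 2 and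
-- one of degree 3.
total-extremal : ∀ f j → total f (extremal (suc j)) ≡
  (8 + 8 * j) * (f 2 + f 5) + (2 * (f 3 + f 6) + 2 * j * f 8)
total-extremal f j rewrite leftDegree-core j | rightDegree-core j | innerSum-core f j =
  collect j (f 2) (f 3) (f 5) (f 6) (f 8)
  where
  collect : ∀ j a b c d e →
    a + ((b + (c + ((7 + 8 * j) * a + (b + ((6 + 8 * j) * c + (2 * d + 2 * j * e)))))) + c) ≡
    (8 + 8 * j) * (a + c) + (2 * (b + d) + 2 * j * e)
  collect = solve-∀

-- The order is the sum of the constant 1 over the corners, so the degree count already determines
-- it.
inner-extremal : ∀ k → inner (extremal k) ≡ k * 18
inner-extremal zero    = refl
inner-extremal (suc j) = +-cancelˡ-≡ 2 _ _ (begin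
  2 + inner (extremal (suc j))       ≡⟨ *-identityˡ _ ⟨
  1 * (2 + inner (extremal (suc j))) ≡⟨ total-const 1 (extremal (suc j)) ⟨
  total (λ _ → 1) (extremal (suc j)) ≡⟨ total-extremal (λ _ → 1) j ⟩
  _                                  ≡⟨ collect j ⟩
  2 + suc j * 18                     ∎)
  where
  open ≡-Reasoning
  collect : ∀ j → (8 + 8 * j) * 2 + (2 * 2 + 2 * j * 1) ≡ 2 + suc j * 18
  collect = solve-∀

-- Three consecutive degrees contain at most one of several degrees spaced by 3.
win-2-5-8 : ∀ d → win 2 d 2 + win 2 d 5 + win 2 d 8 ≤ 1
win-2-5-8 0 = ≤-refl
win-2-5-8 1 = ≤-refl
win-2-5-8 2 = ≤-refl
win-2-5-8 3 = ≤-refl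
win-2-5-8 4 = ≤-refl
win-2-5-8 5 = ≤-refl
win-2-5-8 6 = ≤-refl
win-2-5-8 7 = ≤-refl
win-2-5-8 8 = ≤-refl
win-2-5-8 (suc (suc (suc (suc (suc (suc (suc (suc (suc d))))))))) = z≤n

win-3-6 : ∀ d → win 2 d 3 + win 2 d 6 ≤ 1
win-3-6 0 = z≤n
win-3-6 1 = ≤-refl
win-3-6 2 = ≤-refl
win-3-6 3 = ≤-refl
win-3-6 4 = ≤-refl
win-3-6 5 = ≤-refl
win-3-6 6 = ≤-refl
win-3-6 (suc (suc (suc (suc (suc (suc (suc d))))))) = z≤n

win≤1 : ∀ k d x → win k d x ≤ 1
win≤1 k d x = ind≤1 (window? k d x)

total-win-extremal : ∀ k d → total (win 2 d) (extremal k) ≤ 2 + 8 * k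
total-win-extremal zero    d = +-mono-≤ (win≤1 2 d 1) (win≤1 2 d 1)
total-win-extremal (suc j) d = begin
  total (win 2 d) (extremal (suc j))
    ≡⟨ total-extremal (win 2 d) j ⟩
  s * (w 2 + w 5) + (2 * (w 3 + w 6) + 2 * j * w 8)
    -- Raising the multiplicity of degree 8 to `s` gives the degrees 2, 5 and 8 a common factor.
    ≤⟨ +-monoʳ-≤ (s * (w 2 + w 5)) (+-monoʳ-≤ (2 * (w 3 + w 6)) (*-monoˡ-≤ (w 8) 2j≤s)) ⟩
  s * (w 2 + w 5) + (2 * (w 3 + w 6) + s * w 8)
    ≡⟨ collect s (w 2 + w 5) (w 3 + w 6) (w 8) ⟩
  s * (w 2 + w 5 + w 8) + 2 * (w 3 + w 6)
    ≤⟨ +-mono-≤ (*-monoʳ-≤ s (win-2-5-8 d)) (*-monoʳ-≤ 2 (win-3-6 d)) ⟩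
  s * 1 + 2 * 1
    ≡⟨ evaluate j ⟩
  2 + 8 * suc j ∎
  where
  open ≤-Reasoning
  s = 8 + 8 * j
  w = win 2 d
  2j≤s : 2 * j ≤ s
  2j≤s = m≤n⇒m≤o+n 8 (*-monoˡ-≤ j (≤ᵇ⇒≤ 2 8 tt))
  collect : ∀ s a b c → s * a + (2 * b + s * c) ≡ s * (a + c) + 2 * b
  collect = solve-∀
  evaluate : ∀ j → (8 + 8 * j) * 1 + 2 * 1 ≡ 2 + 8 * suc j
  evaluate = solve-∀

pad : ℕ → Triangulation → Triangulation
pad zero    T = T
pad (suc t) T = side ∆ pad t T

inner-pad : ∀ t T → inner (pad t T) ≡ t + inner T
inner-pad zero    T = refl
inner-pad (suc t) T = cong suc (inner-pad t T)

-- An ear on the root side adds one corner and changes the degrees of only two, the ends of that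
-- side.
total-win-pad : ∀ k d t T → total (win k d) (pad t T) ≤ 3 * t + total (win k d) T
total-win-pad k d zero    T = ≤-refl
total-win-pad k d (suc t) T = begin
  w 2 + ((w (1 + leftDegree P) + innerSum w P) + w (1 + rightDegree P))
    ≤⟨ +-mono-≤ (win≤1 k d 2) (+-mono-≤ (+-monoˡ-≤ (innerSum w P) (win≤1 k d (1 + leftDegree P))) (win≤1 k d (1 + rightDegree P))) ⟩
  1 + ((1 + innerSum w P) + 1)
    ≤⟨ m≤m+n _ (w (leftDegree P) + w (rightDegree P)) ⟩
  1 + ((1 + innerSum w P) + 1) + (w (leftDegree P) + w (rightDegree P))
    ≡⟨ collect (innerSum w P) (w (leftDegree P)) (w (rightDegree P)) ⟩
  3 + total w P
    ≤⟨ +-monoʳ-≤ 3 (total-win-pad k d t T) ⟩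
  3 + (3 * t + total w T)
    ≡⟨ shift t (total w T) ⟩
  3 * suc t + total w T ∎
  where
  open ≤-Reasoning
  w = win k d
  P = pad t T
  collect : ∀ a b c → 1 + ((1 + a) + 1) + (b + c) ≡ 3 + (b + (a + c))
  collect = solve-∀
  shift : ∀ t x → 3 + (3 * t + x) ≡ 3 * suc t + x
  shift = solve-∀

sp-graph≤ : ∀ k T {M} → (∀ d → total (win k d) T ≤ M) → sp (graph T (2 + inner T)) k ≤ M
sp-graph≤ k T total≤M = sp≤ (graph T _) k λ {d} _ → ≤-trans (≤-reflexive (graph-sum (win k d) T)) (total≤M d)

-- The minimum over all triangulations.

-- These are the trees of height at most `h`, among them all with at most `h` inner corners; `best`
-- filters them by order.
triangulations : ℕ → List Triangulation
triangulations zero    = side ∷ []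
triangulations (suc h) = side ∷ cartesianProductWith _∆_ (triangulations h) (triangulations h)

∈-triangulations : ∀ T {h} → inner T ≤ h → T ∈ triangulations h
∈-triangulations side    {zero}  _ = here refl
∈-triangulations side    {suc h} _ = here refl
∈-triangulations (L ∆ R) {zero}  m≤0 with () ← ≤-trans (≤-reflexive (sym (+-suc (inner L) (inner R)))) m≤0
∈-triangulations (L ∆ R) {suc h} m≤h = there (∈-cartesianProductWith⁺ _∆_
  (∈-triangulations L (≤-trans (m≤m+n _ _) m≤h′)) (∈-triangulations R (≤-trans (m≤n+m _ _) m≤h′)))
  where
  m≤h′ : inner L + inner R ≤ h
  m≤h′ = s≤s⁻¹ (≤-trans (≤-reflexive (sym (+-suc (inner L) (inner R)))) m≤h)

abstract
  -- The start value of `argmin` is a fan, which has order `n` when `2 ≤ n`. Being abstract, the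
  -- minimisation is never evaluated.
  best : ℕ → Triangulation
  best n = argmin (λ T → sp (graph T n) 2) (pad (n ∸ 2) side)
    (filter (λ T → 2 + inner T ≟ n) (triangulations n))

  order-best : ∀ {n} → 2 ≤ n → 2 + inner (best n) ≡ n
  order-best {n} 2≤n = argmin-all (λ T → sp (graph T n) 2) {P = λ T → 2 + inner T ≡ n}
    (trans (cong (λ m → 2 + m) (trans (inner-pad (n ∸ 2) side) (+-identityʳ _))) (m+[n∸m]≡n 2≤n))
    (All.all-filter (λ T → 2 + inner T ≟ n) (triangulations n))

  best-minimal : ∀ {n} T → 2 + inner T ≡ n → sp (graph (best n) n) 2 ≤ sp (graph T n) 2
  best-minimal {n} T order = All.lookup
    (f[argmin]≤f[xs] {f = λ T → sp (graph T n) 2} (pad (n ∸ 2) side) (filter (λ T → 2 + inner T ≟ n) (triangulations n)))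
    (∈-filter⁺ (λ S → 2 + inner S ≟ n) (∈-triangulations T (≤-trans (m≤n+m _ 2) (≤-reflexive order))) order)

MOP₂ : ℕ → ℕ
MOP₂ n = sp (graph (best n) n) 2

-- `G` and the graph of its triangulation have equally many vertices in every degree window, and
-- these counts determine `sp`.
MOP₂≤sp : ∀ {m} (G : Graph (2 + m)) → IsMOP G → MOP₂ (2 + m) ≤ sp G 2
MOP₂≤sp {m} G mop with MOP⇒covers {m} G mop
... | T , refl , π , cover , chord⇒edge = ≤-trans (best-minimal T refl)
  (sp≤ (graph T _) 2 λ {d} d≤n → ≤-trans
    (≤-reflexive (trans (graph-sum (win 2 d) T) (sym (sum-over-degrees (win 2 d) T G π cover chord⇒edge))))
    (count≤sp G 2 d≤n))

MOP₂-isMOPNumber : ∀ {n} → 2 ≤ n → IsMOPNumber n 2 (MOP₂ n)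
MOP₂-isMOPNumber {1} (s≤s ())
MOP₂-isMOPNumber {n@(suc (suc _))} 2≤n = record
  { attained   = graph (best n) n , subst (λ n′ → IsMOP (graph (best n) n′)) (order-best 2≤n) (graph-isMOP (best n)) , refl
  ; lowerBound = MOP₂≤sp
  }

MOP₂-lower : ∀ {n} → 5 ≤ n → 4 * n + 10 ≤ 9 * MOP₂ n
MOP₂-lower {n} 5≤n = subst (λ n′ → 4 * n′ + 10 ≤ 9 * sp (graph T n′) 2) order
  (windows≤⇒order≤ T 2≤inner λ {d} d≤5 → ≤-trans (≤-reflexive (sym (graph-sum (win 2 d) T)))
    (count≤sp (graph T _) 2 (≤-trans d≤5 (≤-trans 5≤n (≤-reflexive (sym order))))))
  where
  T = best n
  order : 2 + inner T ≡ n
  order = order-best (≤-trans (≤ᵇ⇒≤ 2 5 tt) 5≤n)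
  2≤inner : 2 ≤ inner T
  2≤inner = +-cancelˡ-≤ 2 2 _ (≤-trans (≤ᵇ⇒≤ 4 5 tt) (≤-trans 5≤n (≤-reflexive (sym order))))

-- The order 2 + 18k comes from `extremal k`; each of the `t` remaining corners is an ear that costs
-- at most 3.
MOP₂-upper : ∀ {n} k t → n ≡ 2 + (t + k * 18) → MOP₂ n ≤ 2 + 8 * k + 3 * t
MOP₂-upper k t refl = ≤-trans (best-minimal T order)
  (subst (λ n → sp (graph T n) 2 ≤ 2 + 8 * k + 3 * t) order (sp-graph≤ 2 T λ d →
    ≤-trans (total-win-pad 2 d t (extremal k))
      (≤-trans (+-monoʳ-≤ (3 * t) (total-win-extremal k d)) (≤-reflexive (+-comm (3 * t) _)))))
  where
  T = pad t (extremal k)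
  order : 2 + inner T ≡ 2 + (t + k * 18)
  order = cong (λ m → 2 + m) (trans (inner-pad t (extremal k)) (cong (λ m → t + m) (inner-extremal k)))

-- Ceilings and explicit constants.

*9-cancel-<suc : ∀ i j → i ℤ.* + 9 ℤ.< ℤ.suc j ℤ.* + 9 → i ℤ.≤ j
*9-cancel-<suc i j 9i<9sj = subst (i ℤ.≤_) (ℤ.pred-suc j)
  (ℤ.i<j⇒i≤pred[j] {i} {ℤ.suc j} (ℤ.*-cancelʳ-<-nonNeg {i} {ℤ.suc j} (+ 9) 9i<9sj))

module _ (a m : ℕ) where
  private
    q = (ℤ.- + a) ℤ./ + 9

    -m*9 : (ℤ.- + m) ℤ.* + 9 ≡ ℤ.- + (m * 9)
    -m*9 = trans (sym (ℤ.neg-distribˡ-* (+ m) (+ 9))) (cong ℤ.-_ (sym (ℤ.pos-* m 9)))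

  -- `ceiling` is minus the floor `q` of the negated fraction, so a bound on `q` is proved and then
  -- negated.
  ceiling-a/9≤m : a ≤ m * 9 → ceiling (+ a / 9) ℤ.≤ + m
  ceiling-a/9≤m a≤9m = subst (ℤ.- q ℤ.≤_) (ℤ.neg-involutive (+ m)) (ℤ.neg-mono-≤ -m≤q)
    where
    open ℤ.≤-Reasoning
    -m≤q : ℤ.- + m ℤ.≤ q
    -m≤q = *9-cancel-<suc (ℤ.- + m) q (begin-strict
      (ℤ.- + m) ℤ.* + 9                   ≡⟨ -m*9 ⟩
      ℤ.- + (m * 9)                       ≤⟨ ℤ.neg-mono-≤ (+≤+ a≤9m) ⟩
      ℤ.- + a                             <⟨ ℤ.n<s[n/ℕd]*d (ℤ.- + a) 9 ⟩
      ℤ.suc ((ℤ.- + a) ℤ./ℕ 9) ℤ.* + 9    ≡⟨ cong (λ q → ℤ.suc q ℤ.* + 9) (ℤ.div-pos-is-/ℕ (ℤ.- + a) 9) ⟨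
      ℤ.suc q ℤ.* + 9                     ∎)

  -- Rounding a/9 up reaches m as soon as 9(m - 1) < a, which for integers is 9m ≤ a + 8.
  m≤ceiling-a/9 : m * 9 ≤ a + 8 → + m ℤ.≤ ceiling (+ a / 9)
  m≤ceiling-a/9 9m≤a+8 = subst (ℤ._≤ ℤ.- q) (ℤ.neg-involutive (+ m)) (ℤ.neg-mono-≤ q≤-m)
    where
    open ℤ.≤-Reasoning
    shift : ∀ x → ℤ.- x ≡ + 9 ℤ.+ ℤ.- (+ 9 ℤ.+ x)
    shift = ℤ-solve-∀
    q≤-m : q ℤ.≤ ℤ.- + m
    q≤-m = *9-cancel-<suc q (ℤ.- + m) (begin-strict
      q ℤ.* + 9                           ≤⟨ ℤ.[n/d]*d≤n (ℤ.- + a) (+ 9) ⟩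
      ℤ.- + a                             ≡⟨ shift (+ a) ⟩
      + 9 ℤ.+ ℤ.- + (9 + a)               <⟨ ℤ.+-monoʳ-< (+ 9) (ℤ.neg-mono-< (ℤ.+<+ (s≤s (≤-trans 9m≤a+8 (≤-reflexive (+-comm a 8)))))) ⟩
      + 9 ℤ.+ ℤ.- + (m * 9)               ≡⟨ cong (λ x → + 9 ℤ.+ x) -m*9 ⟨
      + 9 ℤ.+ (ℤ.- + m) ℤ.* + 9           ≡⟨ ℤ.suc-* (ℤ.- + m) (+ 9) ⟨
      ℤ.suc (ℤ.- + m) ℤ.* + 9             ∎)

distance≤ : ∀ {a m c} → a ≤ m * 9 → m * 9 ≤ a + c * 9 →
  ℚᵘ.∣ + m / 1 ℚᵘ.- + a / 9 ∣ ℚᵘ.≤ + c / 1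
distance≤ {a} {m} {c} a≤9m 9m≤a+9c = ℚᵘ.*≤* (begin
  + ℤ.∣ + m ℤ.* + 9 ℤ.+ (ℤ.- + a) ℤ.* + 1 ∣ ℤ.* + 1  ≡⟨ ℤ.*-identityʳ _ ⟩
  + ℤ.∣ + m ℤ.* + 9 ℤ.+ (ℤ.- + a) ℤ.* + 1 ∣          ≡⟨ cong (λ i → + ℤ.∣ i ∣) numerator ⟩
  + (m * 9 ∸ a)                                      ≤⟨ +≤+ (m≤n+o⇒m∸n≤o _ a 9m≤a+9c) ⟩
  + (c * 9)                                          ≡⟨ ℤ.pos-* c 9 ⟩
  + c ℤ.* + 9                                        ∎)
  where
  open ℤ.≤-Reasoning
  numerator : + m ℤ.* + 9 ℤ.+ (ℤ.- + a) ℤ.* + 1 ≡ + (m * 9 ∸ a)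
  numerator = trans (cong₂ ℤ._+_ (sym (ℤ.pos-* m 9)) (ℤ.*-identityʳ (ℤ.- + a)))
    (trans (ℤ.m-n≡m⊖n (m * 9) a) (ℤ.⊖-≥ a≤9m))

-- At most 17 ears are padded. Each costs 27 in nine times the bound and brings 4 through 4n, which
-- leaves at most 23 * 17 = 391 above 4n + 10.
MOP₂-upper′ : ∀ {n} → 2 ≤ n → MOP₂ n * 9 ≤ 4 * n + 401
MOP₂-upper′ {1} (s≤s ())
MOP₂-upper′ {suc (suc r)} _ = begin
  MOP₂ (2 + r) * 9                    ≤⟨ *-monoˡ-≤ 9 (MOP₂-upper k t (cong (λ r → 2 + r) r≡)) ⟩
  (2 + 8 * k + 3 * t) * 9             ≡⟨ split k t ⟩
  4 * (2 + (t + k * 18)) + 10 + 23 * t ≤⟨ +-monoʳ-≤ (4 * (2 + (t + k * 18)) + 10) (*-monoʳ-≤ 23 (s≤s⁻¹ (m%n<n r 18))) ⟩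
  4 * (2 + (t + k * 18)) + 10 + 391   ≡⟨ +-assoc (4 * (2 + (t + k * 18))) 10 391 ⟩
  4 * (2 + (t + k * 18)) + 401        ≡⟨ cong (λ r → 4 * (2 + r) + 401) r≡ ⟨
  4 * (2 + r) + 401                   ∎
  where
  open ≤-Reasoning
  t = r % 18
  k = r ℕ./ 18
  r≡ : r ≡ t + k * 18
  r≡ = m≡m%n+[m/n]*n r 18
  split : ∀ k t → (2 + 8 * k + 3 * t) * 9 ≡ 4 * (2 + (t + k * 18)) + 10 + 23 * t
  split = solve-∀

2≤5 : 2 ≤ 5
2≤5 = ≤ᵇ⇒≤ 2 5 tt

ceiling≤MOP₂ : ∀ n → 5 ≤ n → ceiling (+ (4 * n + 10) / 9) ℤ.≤ + MOP₂ n
ceiling≤MOP₂ n 5≤n = ceiling-a/9≤m (4 * n + 10) (MOP₂ n) (≤-trans (MOP₂-lower 5≤n) (≤-reflexive (*-comm 9 (MOP₂ n))))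

-- For n = 2 + 18k the fraction is the integer 2 + 8k, which `MOP₂-upper` gives with `t` equal to 0.
MOP₂≡ceiling : ∀ n → 5 ≤ n → n % 18 ≡ 2 → + MOP₂ n ≡ ceiling (+ (4 * n + 10) / 9)
MOP₂≡ceiling n 5≤n n%18≡2 = ℤ.≤-antisym
  (ℤ.≤-trans (+≤+ (MOP₂-upper k 0 n≡)) (m≤ceiling-a/9 (4 * n + 10) (2 + 8 * k + 3 * 0) (begin
    (2 + 8 * k + 3 * 0) * 9              ≡⟨ evaluate k ⟩
    4 * (2 + k * 18) + 10                ≡⟨ cong (λ n → 4 * n + 10) n≡ ⟨
    4 * n + 10                           ≤⟨ m≤m+n _ 8 ⟩
    4 * n + 10 + 8                       ∎)))
  (ceiling≤MOP₂ n 5≤n)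
  where
  open ≤-Reasoning
  k = n ℕ./ 18
  n≡ : n ≡ 2 + k * 18
  n≡ = trans (m≡m%n+[m/n]*n n 18) (cong (λ r → r + k * 18) n%18≡2)
  evaluate : ∀ k → (2 + 8 * k + 3 * 0) * 9 ≡ 4 * (2 + k * 18) + 10
  evaluate = solve-∀

-- 43 is the least c with 401 - 9c ≤ 18, where 18 is the 10 of the numerator plus the rounding slack
-- 8.
MOP₂≤ceiling+43 : ∀ n → 20 ≤ n → + MOP₂ n ℤ.≤ ceiling (+ (4 * n + 10) / 9) ℤ.+ + 43
MOP₂≤ceiling+43 n 20≤n = ℤ.≤-trans (+≤+ (m≤n+m∸n (MOP₂ n) 43)) (ℤ.≤-trans (+≤+ (≤-reflexive (+-comm 43 (MOP₂ n ∸ 43))))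
  (ℤ.+-monoˡ-≤ (+ 43) (m≤ceiling-a/9 (4 * n + 10) (MOP₂ n ∸ 43) (begin
    (MOP₂ n ∸ 43) * 9           ≡⟨ *-distribʳ-∸ 9 (MOP₂ n) 43 ⟩
    MOP₂ n * 9 ∸ 387            ≤⟨ ∸-monoˡ-≤ 387 (MOP₂-upper′ (≤-trans (≤ᵇ⇒≤ 2 20 tt) 20≤n)) ⟩
    4 * n + 401 ∸ 387           ≡⟨ +-∸-assoc (4 * n) {401} {387} (≤ᵇ⇒≤ 387 401 tt) ⟩
    4 * n + 14                  ≤⟨ +-monoʳ-≤ (4 * n) (≤ᵇ⇒≤ 14 18 tt) ⟩
    4 * n + 18                  ≡⟨ +-assoc (4 * n) 10 8 ⟨
    4 * n + 10 + 8              ∎))))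
  where open ≤-Reasoning

theorem21 : Σ[ MOP₂ ∈ (ℕ → ℕ) ]
    ( (∀ (n : ℕ) → 5 ≤ n → IsMOPNumber n 2 (MOP₂ n))
    × (∀ (n : ℕ) → 5 ≤ n → ceiling (+ (4 * n + 10) / 9) ℤ.≤ + MOP₂ n)
    × (∀ (n : ℕ) → 5 ≤ n → n % 18 ≡ 2 → + MOP₂ n ≡ ceiling (+ (4 * n + 10) / 9))
    × (∀ (n : ℕ) → 20 ≤ n → + MOP₂ n ℤ.≤ ceiling (+ (4 * n + 10) / 9) ℤ.+ + 43)
    × (∃[ C ] (∀ (n : ℕ) → 5 ≤ n → ℚᵘ.∣ + MOP₂ n / 1 ℚᵘ.- + (4 * n) / 9 ∣ ℚᵘ.≤ + C / 1)) )
theorem21 = MOP₂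
  , (λ n 5≤n → MOP₂-isMOPNumber (≤-trans 2≤5 5≤n))
  , ceiling≤MOP₂
  , MOP₂≡ceiling
  , MOP₂≤ceiling+43
  -- 405 = 45 * 9 is the first multiple of 9 that is at least 401.
  , 45 , λ n 5≤n → distance≤ {4 * n} {MOP₂ n} {45}
      (≤-trans (m≤m+n (4 * n) 10) (≤-trans (MOP₂-lower 5≤n) (≤-reflexive (*-comm 9 (MOP₂ n)))))
      (≤-trans (MOP₂-upper′ (≤-trans 2≤5 5≤n)) (+-monoʳ-≤ (4 * n) (≤ᵇ⇒≤ 401 405 tt)))
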